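{- Let $n=p^2$ where $p$ is an odd prime, and let $G=\langle p-1\rangle$ be the subgroup of $\mathbb{Z}_n^\times$ generated by $p-1$. Then the coset index function $f_G$ is a $(p^2,p,\{p,p^2-p+1\})$ zero-difference function.
   Context: For a subgroup $G$ of $\mathbb{Z}_n^\times$ and $r\in\mathbb{Z}_n$, the coset $rG=\{rg\mid g\in G\}$; these cosets partition $\mathbb{Z}_n$, forming a set $D_G$. The coset index function induced by $G$ is $f_G:\mathbb{Z}_n\to\mathbb{Z}_{|D_G|}$, $f_G(x)=h_G(C_x)$, where $C_x$ is the coset containing $x$ and $h_G:D_G\to\mathbb{Z}_{|D_G|}$ is a fixed bijection. A function $f:A\to B$ between finite abelian groups is an $(n,m,S)$ zero-difference function if $n=|A|$, $m=|f(A)|$, and for every nonzero $a\in A$, $|\{x\in A\mid f(x+a)=f(x)\}|\in S$. Here $A=(\mathbb{Z}_n,+)$. -}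

module Defs where

open import Level using (Level; 0ℓ; _⊔_)
open import Algebra.Bundles using (AbelianGroup; CommutativeRing; Group; Monoid)
open import Algebra.Definitions using (Invertible)
open import Data.Fin.Base using (Fin)
open import Data.Integer.Base using (ℤ; +_; 0ℤ; 1ℤ; -1ℤ; _+_; _*_; _-_; -_)
open import Data.Integer.Divisibility.Signed using (_∣_; divides)
import Data.Integer.Properties as ℤ
open import Data.Integer.Tactic.RingSolver using (solve-∀)
open import Data.Nat.Base as ℕ using (ℕ)
import Data.Nat.Properties as ℕ
open import Data.Product.Base using (Σ; ∃-syntax; _×_; _,_; proj₁; proj₂)
open import Function.Bundles using (Func; Bijection)
import Function.Construct.Composition as Compose
open import Relation.Binary.Bundles using (Setoid)
import Relation.Binary.Construct.On as On
open import Relation.Binary.PropositionalEquality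
  using (_≡_; refl; sym; trans; cong; cong₂; setoid)
open import Relation.Nullary using (¬_)
open import Relation.Unary using (Pred; _∈_; _≐_)

private
  variable
    a b ℓ ℓ′ q : Level

HasCardinality : Setoid a ℓ → ℕ → Set (a ⊔ ℓ)
HasCardinality S k = Bijection S (setoid (Fin k))

Subset : (S : Setoid a ℓ) → Pred (Setoid.Carrier S) q → Setoid (a ⊔ q) ℓ
Subset S P = On.setoid {B = Σ (Setoid.Carrier S) P} S proj₁

Image : {A : Setoid a ℓ} {B : Setoid b ℓ′} → Func A B → Setoid (a ⊔ b ⊔ ℓ′) ℓ′
Image {A = A} {B = B} f =
  Subset B (λ y → Σ (Setoid.Carrier A) (λ x → Setoid._≈_ B (Func.to f x) y))

record IsZeroDifference (A B : AbelianGroup 0ℓ 0ℓ) (n m : ℕ) (S : Pred ℕ 0ℓ)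
  (f : Func (AbelianGroup.setoid A) (AbelianGroup.setoid B)) : Set where
  private
    module A = AbelianGroup A
    module B = AbelianGroup B
  open Func f using (to)
  field
    domain-size     : HasCardinality A.setoid n
    codomain-finite : ∃[ k ] HasCardinality B.setoid k
    image-size      : HasCardinality (Image f) m
    differences     : ∀ a → ¬ (a A.≈ A.ε) →
      ∃[ k ] (k ∈ S) ×
             HasCardinality (Subset A.setoid (λ x → to (x A.∙ a) B.≈ to x)) k

-- Without quotient types, ℤ/n is ℤ with congruence modulo n as its equality.
module _ (n : ℕ) where

  infix 4 _≈ₙ_
  record _≈ₙ_ (x y : ℤ) : Set where
    constructor congruent
    field difference : + n ∣ x - y

  private
    ≡⇒≈ : ∀ {x y} → x ≡ y → x ≈ₙ y
    ≡⇒≈ {x} refl = congruent (divides 0ℤ (ℤ.+-inverseʳ x))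

    ≈-sym : ∀ {x y} → x ≈ₙ y → y ≈ₙ x
    ≈-sym {x} {y} (congruent (divides k e)) = congruent (divides (- k)
      (trans (flip x y) (trans (cong -_ e) (ℤ.neg-distribˡ-* k (+ n)))))
      where
      flip : ∀ x y → y - x ≡ - (x - y)
      flip = solve-∀

    ≈-trans : ∀ {x y z} → x ≈ₙ y → y ≈ₙ z → x ≈ₙ z
    ≈-trans {x} {y} {z} (congruent (divides k e)) (congruent (divides l e′)) =
      congruent (divides (k + l)
      (trans (split x y z)
      (trans (cong₂ _+_ e e′) (sym (ℤ.*-distribʳ-+ (+ n) k l)))))
      where
      split : ∀ x y z → x - z ≡ (x - y) + (y - z)
      split = solve-∀

    +-cong : ∀ {x y u v} → x ≈ₙ y → u ≈ₙ v → x + u ≈ₙ y + v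
    +-cong {x} {y} {u} {v} (congruent (divides k e)) (congruent (divides l e′)) =
      congruent (divides (k + l)
      (trans (split x y u v)
      (trans (cong₂ _+_ e e′) (sym (ℤ.*-distribʳ-+ (+ n) k l)))))
      where
      split : ∀ x y u v → (x + u) - (y + v) ≡ (x - y) + (u - v)
      split = solve-∀

    *-cong : ∀ {x y u v} → x ≈ₙ y → u ≈ₙ v → x * u ≈ₙ y * v
    *-cong {x} {y} {u} {v} (congruent (divides k e)) (congruent (divides l e′)) =
      congruent (divides (k * u + y * l)
        (trans (split x y u v)
        (trans (cong₂ (λ s t → s * u + y * t) e e′) (collect k l u y (+ n)))))
      where
      split : ∀ x y u v → x * u - y * v ≡ (x - y) * u + y * (u - v)
      split = solve-∀
      collect : ∀ k l u y m → k * m * u + y * (l * m) ≡ (k * u + y * l) * m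
      collect = solve-∀

    -‿cong : ∀ {x y} → x ≈ₙ y → - x ≈ₙ - y
    -‿cong {x} {y} (congruent (divides k e)) = congruent (divides (- k)
      (trans (factor x y) (trans (cong -_ e) (ℤ.neg-distribˡ-* k (+ n)))))
      where
      factor : ∀ x y → - x - - y ≡ - (x - y)
      factor = solve-∀

  ℤ/ : CommutativeRing 0ℓ 0ℓ
  ℤ/ = record
    { Carrier = ℤ
    ; _≈_     = _≈ₙ_
    ; _+_     = _+_
    ; _*_     = _*_
    ; -_      = -_
    ; 0#      = 0ℤ
    ; 1#      = 1ℤ
    ; isCommutativeRing = record
      { isRing = record
        { +-isAbelianGroup = record
          { isGroup = record
            { isMonoid = record
              { isSemigroup = record
                { isMagma = record
                  { isEquivalence = record
                    { refl = ≡⇒≈ refl ; sym = ≈-sym ; trans = ≈-trans }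
                  ; ∙-cong = +-cong
                  }
                ; assoc = λ x y z → ≡⇒≈ (ℤ.+-assoc x y z)
                }
              ; identity = (λ x → ≡⇒≈ (ℤ.+-identityˡ x))
                         , (λ x → ≡⇒≈ (ℤ.+-identityʳ x))
              }
            ; inverse = (λ x → ≡⇒≈ (ℤ.+-inverseˡ x))
                      , (λ x → ≡⇒≈ (ℤ.+-inverseʳ x))
            ; ⁻¹-cong = -‿cong
            }
          ; comm = λ x y → ≡⇒≈ (ℤ.+-comm x y)
          }
        ; *-cong = *-cong
        ; *-assoc = λ x y z → ≡⇒≈ (ℤ.*-assoc x y z)
        ; *-identity = (λ x → ≡⇒≈ (ℤ.*-identityˡ x))
                     , (λ x → ≡⇒≈ (ℤ.*-identityʳ x))
        ; distrib = (λ x y z → ≡⇒≈ (ℤ.*-distribˡ-+ x y z))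
                  , (λ x y z → ≡⇒≈ (ℤ.*-distribʳ-+ x y z))
        }
      ; *-comm = λ x y → ≡⇒≈ (ℤ.*-comm x y)
      }
    }

ℤ/-additive : ℕ → AbelianGroup 0ℓ 0ℓ
ℤ/-additive n = CommutativeRing.+-abelianGroup (ℤ/ n)

ℤ/-setoid : ℕ → Setoid 0ℓ 0ℓ
ℤ/-setoid n = CommutativeRing.setoid (ℤ/ n)

-- Equality of units only compares the underlying elements, not the inverses.
Units : Monoid a ℓ → Group (a ⊔ ℓ) ℓ
Units M = record
  { Carrier = Unit
  ; _≈_     = λ u v → proj₁ u ≈ proj₁ v
  ; _∙_     = mul
  ; ε       = ε , ε , identityˡ ε , identityʳ ε
  ; _⁻¹     = λ (u , u⁻¹ , l , r) → u⁻¹ , u , r , l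
  ; isGroup = record
    { isMonoid = record
      { isSemigroup = record
        { isMagma = record
          { isEquivalence = On.isEquivalence proj₁ isEquivalence
          ; ∙-cong = ∙-cong
          }
        ; assoc = λ u v w → assoc (proj₁ u) (proj₁ v) (proj₁ w)
        }
      ; identity = (λ u → identityˡ (proj₁ u)) , (λ u → identityʳ (proj₁ u))
      }
    ; inverse = (λ (_ , _ , l , _) → l) , (λ (_ , _ , _ , r) → r)
    ; ⁻¹-cong = λ {u} {v} → inverse-unique u v
    }
  }
  where
  open Monoid M renaming (refl to ≈-refl; sym to ≈-sym; trans to ≈-trans)

  Unit : Set _
  Unit = Σ Carrier (Invertible _≈_ ε _∙_)

  cancel : ∀ {x y z w} → y ∙ z ≈ ε → x ∙ w ≈ ε → (x ∙ y) ∙ (z ∙ w) ≈ ε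
  cancel {x} {y} {z} {w} yz xw =
    ≈-trans (assoc x y (z ∙ w))
    (≈-trans (∙-congˡ (≈-trans (≈-sym (assoc y z w))
                        (≈-trans (∙-congʳ yz) (identityˡ w))))
             xw)

  mul : Unit → Unit → Unit
  mul (u , u⁻¹ , ul , ur) (v , v⁻¹ , vl , vr) =
    u ∙ v , v⁻¹ ∙ u⁻¹ , cancel ul vl , cancel vr ur

  inverse-unique : (u v : Unit) → proj₁ u ≈ proj₁ v →
                   proj₁ (proj₂ u) ≈ proj₁ (proj₂ v)
  inverse-unique (u , u⁻¹ , ul , ur) (v , v⁻¹ , vl , vr) u≈v =
    ≈-trans (≈-sym (identityʳ u⁻¹))
    (≈-trans (∙-congˡ (≈-sym vr))
    (≈-trans (≈-sym (assoc u⁻¹ v v⁻¹))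
    (≈-trans (∙-congʳ (≈-trans (∙-congˡ (≈-sym u≈v)) ul))
             (identityˡ v⁻¹))))

record Subgroup (Γ : Group a ℓ) (q : Level) : Set (a ⊔ ℓ ⊔ Level.suc q) where
  open Group Γ using (Carrier; _≈_; _∙_; ε; _⁻¹)
  field
    Member    : Pred Carrier q
    resp-≈    : ∀ {x y} → x ≈ y → x ∈ Member → y ∈ Member
    ∙-closed  : ∀ {x y} → x ∈ Member → y ∈ Member → (x ∙ y) ∈ Member
    ε-closed  : ε ∈ Member
    ⁻¹-closed : ∀ {x} → x ∈ Member → (x ⁻¹) ∈ Member

module _ (Γ : Group a ℓ) where
  open Group Γ using (Carrier; _≈_; _∙_; ε; _⁻¹)

  data Generated (g : Carrier) : Pred Carrier (a ⊔ ℓ) where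
    generator : Generated g g
    respects  : ∀ {x y} → x ≈ y → Generated g x → Generated g y
    product   : ∀ {x y} → Generated g x → Generated g y →
                Generated g (x ∙ y)
    identity  : Generated g ε
    inverse   : ∀ {x} → Generated g x → Generated g (x ⁻¹)

generatedBy : (Γ : Group a ℓ) → Group.Carrier Γ → Subgroup Γ (a ⊔ ℓ)
generatedBy Γ g = record
  { Member    = Generated Γ g
  ; resp-≈    = respects
  ; ∙-closed  = product
  ; ε-closed  = identity
  ; ⁻¹-closed = inverse
  }

ℤ/-units : ℕ → Group 0ℓ 0ℓ
ℤ/-units n = Units (CommutativeRing.*-monoid (ℤ/ n))

module _ {n : ℕ} (G : Subgroup (ℤ/-units n) 0ℓ) where
  open CommutativeRing (ℤ/ n) using (_≈_)
    renaming (refl to ≈-refl; sym to ≈-sym; trans to ≈-trans;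
              *-cong to mul-cong; *-assoc to mul-assoc;
              *-identityʳ to mul-identityʳ)
  open Subgroup G

  Coset : ℤ → Pred ℤ 0ℓ
  Coset r x = ∃[ g ] (g ∈ Member) × (x ≈ r * proj₁ g)

  -- An element r of this setoid stands for the coset rG; two elements are
  -- equal when their cosets are equal as subsets of ℤ/n.
  Cosets : Setoid 0ℓ 0ℓ
  Cosets = record
    { Carrier       = ℤ
    ; _≈_           = λ r s → Coset r ≐ Coset s
    ; isEquivalence = record
      { refl  = (λ m → m) , (λ m → m)
      ; sym   = λ (i , j) → j , i
      ; trans = λ (i , j) (k , l) → (λ m → k (i m)) , (λ m → j (l m))
      }
    }

  ∈-Coset : ∀ x → x ∈ Coset x
  ∈-Coset x = Group.ε (ℤ/-units n) , ε-closed , ≈-sym (mul-identityʳ x)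

  -- Together with ∈-Coset: xG is the unique coset containing x.
  Coset-unique : ∀ {r x} → x ∈ Coset r → Coset r ≐ Coset x
  Coset-unique {r} {x} (g@(g₀ , g⁻¹ , gl , gr) , g∈G , x≈rg) =
    (λ (h , h∈G , y≈rh) → _ , ∙-closed (⁻¹-closed g∈G) h∈G ,
      ≈-trans y≈rh (≈-trans (mul-cong r≈xg⁻¹ ≈-refl) (mul-assoc x g⁻¹ (proj₁ h)))) ,
    (λ (h , h∈G , y≈xh) → _ , ∙-closed g∈G h∈G ,
      ≈-trans y≈xh (≈-trans (mul-cong x≈rg ≈-refl) (mul-assoc r g₀ (proj₁ h))))
    where
    r≈xg⁻¹ : r ≈ x * g⁻¹
    r≈xg⁻¹ = ≈-sym (≈-trans (mul-cong x≈rg ≈-refl)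
                   (≈-trans (mul-assoc r g₀ g⁻¹)
                   (≈-trans (mul-cong (≈-refl {r}) gr) (mul-identityʳ r))))

  cosetOf : Func (ℤ/-setoid n) Cosets
  cosetOf = record
    { to   = λ x → x
    ; cong = λ {x} {y} x≈y →
        (λ (g , g∈G , e) → g , g∈G , ≈-trans e (mul-cong x≈y ≈-refl)) ,
        (λ (g , g∈G , e) → g , g∈G , ≈-trans e (mul-cong (≈-sym x≈y) ≈-refl))
    }

  cosetIndex : {d : ℕ} → Bijection Cosets (ℤ/-setoid d) →
               Func (ℤ/-setoid n) (ℤ/-setoid d)
  cosetIndex h = Compose.function cosetOf
    (record { to = Bijection.to h ; cong = Bijection.cong h })

-- The unit p - 1; its inverse is - (p + 1), as (p - 1)(p + 1) = p² - 1.
predUnit : (p : ℕ) → Group.Carrier (ℤ/-units (p ℕ.^ 2))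
predUnit p = + p - 1ℤ , - (+ p + 1ℤ) , congruent (divides -1ℤ left) , congruent (divides -1ℤ right)
  where
  p² : + (p ℕ.^ 2) ≡ + p * + p
  p² = trans (cong (λ t → + (p ℕ.* t)) (ℕ.*-identityʳ p)) (ℤ.pos-* p p)

  left : - (+ p + 1ℤ) * (+ p - 1ℤ) - 1ℤ ≡ -1ℤ * + (p ℕ.^ 2)
  left = trans (identity′ (+ p)) (cong (-1ℤ *_) (sym p²))
    where
    identity′ : ∀ x → - (x + 1ℤ) * (x - 1ℤ) - 1ℤ ≡ -1ℤ * (x * x)
    identity′ = solve-∀

  right : (+ p - 1ℤ) * - (+ p + 1ℤ) - 1ℤ ≡ -1ℤ * + (p ℕ.^ 2)
  right = trans (identity′ (+ p)) (cong (-1ℤ *_) (sym p²))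
    where
    identity′ : ∀ x → (x - 1ℤ) * - (x + 1ℤ) - 1ℤ ≡ -1ℤ * (x * x)
    identity′ = solve-∀

{-# OPTIONS --safe #-}

-- Write p = 2q + 1. Since (p - 1)² ≡ 1 - 2p, the powers of (p - 1)² are all the
-- 1 + ap modulo p², and (p - 1)(1 + p) ≡ -1, so G consists of the units that are
-- ±1 modulo p. Hence two units share a coset iff they agree up to sign modulo p,
-- and two multiples of p iff they agree up to sign modulo p². Representatives of
-- the cosets are 1, …, q and 0, p, …, qp, which makes p of them.
-- If p ∤ a, then f(x + a) = f(x) iff 2x + a ≡ 0 (mod p), so there are p solutions.
-- If p ∣ a and a ≢ 0, all p² - p units are solutions, and a multiple x of p is one
-- iff 2x + a ≡ 0 (mod p²), which adds a single solution.
module Submission where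

open import Defs
open import Data.Nat.Base using (ℕ; _∸_; _^_)
open import Data.Nat.Divisibility using (_∤_)
open import Data.Nat.Primality using (Prime)
open import Function.Bundles using (Bijection)
open import Relation.Unary using (｛_｝; _∪_)

open import Level using (Level; 0ℓ)
open import Algebra.Bundles using (CommutativeRing; Group)
open import Data.Fin.Base using (Fin; toℕ; fromℕ<)
open import Data.Fin.Properties using (toℕ<n; toℕ-fromℕ<; toℕ-injective; +↔⊎; *↔×; 1↔⊤)
open import Data.Integer.Base as ℤ using (ℤ; +_; -[1+_]; 0ℤ; 1ℤ; -1ℤ)
open import Data.Integer.Divisibility.Signed
  using (_∣_; divides; _∣?_; ∣⇒∣ᵤ; ∣ᵤ⇒∣; ∣-refl; ∣-trans; ∣m∣n⇒∣m+n; ∣m∣n⇒∣m-n;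
         ∣m⇒∣-m; ∣n⇒∣m*n; ∣m⇒∣m*n; *-monoʳ-∣; *-monoˡ-∣; *-cancelˡ-∣)
open import Data.Integer.DivMod using (_%ℕ_; _/ℕ_; n%ℕd<d; a≡a%ℕn+[a/ℕn]*n)
import Data.Integer.Properties as ℤ
open import Data.Integer.Tactic.RingSolver using (solve-∀)
open import Data.Nat.Base as ℕ using (suc; NonZero; s≤s; z≤n)
open import Data.Nat.Coprimality using (Coprime; coprime-Bézout)
open import Data.Nat.DivMod using (_/_; _%_; m%n<n; m≡m%n+[m/n]*n)
import Data.Nat.Divisibility as ℕ
open import Data.Nat.GCD using (module Bézout)
open import Data.Nat.Primality using (prime⇒nonZero; prime⇒irreducible)
import Data.Nat.Properties as ℕ
import Data.Nat.Tactic.RingSolver as ℕSolver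
open import Data.Product.Base using (∃-syntax; _×_; _,_; proj₁; proj₂)
open import Data.Sum.Base using (_⊎_; inj₁; inj₂)
open import Data.Sum.Function.Propositional using (_⊎-↔_)
open import Data.Unit.Base using (⊤; tt)
open import Function.Base using (_∘_; _$_)
open import Function.Bundles using (_↔_; Inverse)
open import Function.Construct.Composition using (_↔-∘_)
open import Function.Construct.Identity using (↔-id)
open import Relation.Binary.Bundles using (Setoid)
open import Relation.Binary.PropositionalEquality
  using (_≡_; refl; sym; trans; cong; cong₂; subst)
open import Relation.Nullary using (¬_; Dec; yes; no; contradiction)
open import Relation.Unary using (Pred; _∈_; _≐_)

∣-respʳ : ∀ {d x y} → x ≡ y → d ∣ x → d ∣ y
∣-respʳ refl d = d

-- Cardinality from a list of representatives.

module _ {a ℓ : Level} (S : Setoid a ℓ) where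
  open Setoid S renaming (sym to ≈-sym; trans to ≈-trans)

  -- Each element goes to the index of the representative it equals; `rep-injective` makes that
  -- index independent of the choice. The index type `I` is kept apart from `Fin k` so that sums and
  -- products can serve as indices.
  enumeration : {I : Set} {k : ℕ} → Fin k ↔ I → (rep : I → Carrier) →
                (∀ {i j} → rep i ≈ rep j → i ≡ j) →
                (∀ x → ∃[ i ] x ≈ rep i) → HasCardinality S k
  enumeration {I} {k} Fin↔I rep rep-injective cover = record
    { to        = to
    ; cong      = λ {x} {y} x≈y → cong I.from
        (rep-injective (≈-trans (≈-sym (covered x)) (≈-trans x≈y (covered y))))
    ; bijective =
        (λ {x} {y} e → ≈-trans (covered x) (≈-trans
          (reflexive (cong rep (from-injective e))) (≈-sym (covered y)))) ,
        (λ i → rep (I.to i) , λ {z} z≈ →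
          trans (cong I.from (rep-injective (≈-trans (≈-sym (covered z)) z≈)))
                (I.strictlyInverseʳ i))
    }
    where
    module I = Inverse Fin↔I
    to : Carrier → Fin k
    to x = I.from (proj₁ (cover x))
    covered : ∀ x → x ≈ rep (proj₁ (cover x))
    covered x = proj₂ (cover x)
    from-injective : ∀ {i j} → I.from i ≡ I.from j → i ≡ j
    from-injective {i} {j} e =
      trans (sym (I.strictlyInverseˡ i)) (trans (cong I.to e) (I.strictlyInverseˡ j))

-- Residues modulo m and inverses modulo a prime.

multiple-below⇒0 : ∀ {m x} → + m ∣ x → ℤ.∣ x ∣ ℕ.< m → x ≡ 0ℤ
multiple-below⇒0 {m} {x} m∣x x<m with ℤ.∣ x ∣ in eq
... | 0     = ℤ.∣i∣≡0⇒i≡0 eq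
... | suc k = contradiction (subst (m ℕ.∣_) eq (∣⇒∣ᵤ m∣x)) (ℕ.>⇒∤ x<m)

residue-injective : ∀ {m i j} → i ℕ.< m → j ℕ.< m → + m ∣ + i ℤ.- + j → i ≡ j
residue-injective {m} {i} {j} i<m j<m m∣i-j =
  ℤ.+-injective (ℤ.i-j≡0⇒i≡j (+ i) (+ j) (multiple-below⇒0 m∣i-j
    (subst (λ t → ℤ.∣ t ∣ ℕ.< m) (sym (ℤ.m-n≡m⊖n i j))
      (ℕ.≤-<-trans (ℤ.∣m⊝n∣≤m⊔n i j) (ℕ.⊔-lub i<m j<m)))))

residue : ∀ m .{{_ : NonZero m}} (x : ℤ) → ∃[ i ] + m ∣ x ℤ.- + toℕ {m} i
residue m x = fromℕ< r<m , divides (x /ℕ m) (trans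
  (cong₂ (λ s t → s ℤ.- + t) (a≡a%ℕn+[a/ℕn]*n x m) (toℕ-fromℕ< r<m))
  (cancel (+ (x %ℕ m)) (x /ℕ m ℤ.* + m)))
  where
  r<m = n%ℕd<d x m
  cancel : ∀ r t → r ℤ.+ t ℤ.- r ≡ t
  cancel = solve-∀

ℤ/-cardinality : ∀ m .{{_ : NonZero m}} → HasCardinality (ℤ/-setoid m) m
ℤ/-cardinality m = enumeration (ℤ/-setoid m) (↔-id (Fin m)) (λ i → + toℕ i)
  (λ {i} {j} (congruent d) → toℕ-injective (residue-injective (toℕ<n i) (toℕ<n j) d))
  (λ x → proj₁ (residue m x) , congruent (proj₂ (residue m x)))

-- A number not divisible by p is coprime to p, and its Bézout coefficient is the inverse. Over the
-- naturals the Bézout identity has two forms, according to which side is larger; a negative r takes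
-- the negated inverse of its absolute value.
prime∤⇒invertible : ∀ {p} → Prime p → ∀ r → ¬ + p ∣ r → ∃[ s ] + p ∣ r ℤ.* s ℤ.- 1ℤ
prime∤⇒invertible {p} p-prime (+ m) p∤m = invert (coprime-Bézout m⊥p)
  where
  m⊥p : Coprime m p
  m⊥p (d∣m , d∣p) with prime⇒irreducible p-prime d∣p
  ... | inj₁ d≡1  = d≡1
  ... | inj₂ refl = contradiction (∣ᵤ⇒∣ d∣m) p∤m

  invert : Bézout.Identity 1 m p → ∃[ s ] + p ∣ + m ℤ.* s ℤ.- 1ℤ
  invert (Bézout.+- x y eq) = + x , divides (+ y) (expand (+ m) (+ x) (+ y) (+ p)
    (trans (cong (ℤ._+_ 1ℤ) (sym (ℤ.pos-* y p))) (trans (cong +_ eq) (ℤ.pos-* x m))))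
    where
    expand : ∀ m x y p → 1ℤ ℤ.+ y ℤ.* p ≡ x ℤ.* m → m ℤ.* x ℤ.- 1ℤ ≡ y ℤ.* p
    expand m x y p e = trans (cong (ℤ._- 1ℤ) (trans (ℤ.*-comm m x) (sym e))) (cancel (y ℤ.* p))
      where
      cancel : ∀ t → 1ℤ ℤ.+ t ℤ.- 1ℤ ≡ t
      cancel = solve-∀
  invert (Bézout.-+ x y eq) = ℤ.- + x , divides (ℤ.- + y) (expand (+ m) (+ x) (+ y) (+ p)
    (trans (cong (ℤ._+_ 1ℤ) (sym (ℤ.pos-* x m))) (trans (cong +_ eq) (ℤ.pos-* y p))))
    where
    expand : ∀ m x y p → 1ℤ ℤ.+ x ℤ.* m ≡ y ℤ.* p → m ℤ.* (ℤ.- x) ℤ.- 1ℤ ≡ ℤ.- y ℤ.* p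
    expand m x y p e = trans (factor m x) (trans (cong ℤ.-_ e) (ℤ.neg-distribˡ-* y p))
      where
      factor : ∀ m x → m ℤ.* (ℤ.- x) ℤ.- 1ℤ ≡ ℤ.- (1ℤ ℤ.+ x ℤ.* m)
      factor = solve-∀
prime∤⇒invertible p-prime r@(-[1+ m ]) p∤r
  with s , p∣ ← prime∤⇒invertible p-prime (+ suc m) (p∤r ∘ ∣m⇒∣-m)
  = ℤ.- s , ∣-respʳ (flip (+ suc m) s) p∣
  where
  flip : ∀ x s → x ℤ.* s ℤ.- 1ℤ ≡ ℤ.- x ℤ.* ℤ.- s ℤ.- 1ℤ
  flip = solve-∀

-- Signs, and integers that underlie a member of a set of units.

IsSign : Pred ℤ 0ℓ
IsSign ε = ε ≡ 1ℤ ⊎ ε ≡ -1ℤ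

sign-* : ∀ {ε δ} → IsSign ε → IsSign δ → IsSign (ε ℤ.* δ)
sign-* (inj₁ refl) (inj₁ refl) = inj₁ refl
sign-* (inj₁ refl) (inj₂ refl) = inj₂ refl
sign-* (inj₂ refl) (inj₁ refl) = inj₂ refl
sign-* (inj₂ refl) (inj₂ refl) = inj₁ refl

sign²≡1 : ∀ {ε} → IsSign ε → ε ℤ.* ε ≡ 1ℤ
sign²≡1 (inj₁ refl) = refl
sign²≡1 (inj₂ refl) = refl

-- A unit carries a chosen inverse, so membership is no predicate on integers. This one speaks of
-- the residue alone and leaves the inverse to the witness.
record Attained {n : ℕ} (M : Pred (Group.Carrier (ℤ/-units n)) 0ℓ) (z : ℤ) : Set where
  constructor attained
  field
    unit   : Group.Carrier (ℤ/-units n)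
    member : unit ∈ M
    value  : _≈ₙ_ n z (proj₁ unit)

-- Congruences modulo p and p², and signed residues modulo p.

module _ {p q : ℕ} (p-prime : Prime p) (p≡q+1+q : p ≡ q ℕ.+ suc q) where
  open import Data.Integer.Base using (_+_; _*_; _-_; -_)

  private
    P Q : ℤ
    P = + p
    Q = + q

    instance
      p-nonZero : NonZero p
      p-nonZero = prime⇒nonZero p-prime

    P≡Q+1+Q : P ≡ Q + (1ℤ + Q)
    P≡Q+1+Q = cong +_ p≡q+1+q

    p²≡P² : + (p ^ 2) ≡ P * P
    p²≡P² = trans (cong (λ t → + (p ℕ.* t)) (ℕ.*-identityʳ p)) (ℤ.pos-* p p)

    P²∣⇒P∣ : ∀ {x} → P * P ∣ x → P ∣ x
    P²∣⇒P∣ = ∣-trans (divides P refl)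

    P∣⇒P²∣P* : ∀ {x} → P ∣ x → P * P ∣ P * x
    P∣⇒P²∣P* = *-monoʳ-∣ P

    P²∣P*⇒P∣ : ∀ {x} → P * P ∣ P * x → P ∣ x
    P²∣P*⇒P∣ = *-cancelˡ-∣ P

  open CommutativeRing (ℤ/ (p ^ 2)) using (_≈_)
    renaming (sym to ≈-sym; trans to ≈-trans; *-cong to ≈-*-cong)

  P²∣⇒≈ : ∀ {x y} → P * P ∣ x - y → x ≈ y
  P²∣⇒≈ d = congruent (subst (_∣ _) (sym p²≡P²) d)

  ≈⇒P²∣ : ∀ {x y} → x ≈ y → P * P ∣ x - y
  ≈⇒P²∣ (congruent d) = subst (_∣ _) p²≡P² d

  -- A residue r above q is replaced by -(p - r), where p - r ≤ q because p = 2q + 1.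
  signedResidue : ∀ x → ∃[ i ] ∃[ ε ] IsSign ε × P ∣ x - ε * + toℕ {suc q} i
  signedResidue x with residue p x
  ... | r , p∣x-r with toℕ r ℕ.≤? q
  ...   | yes r≤q = fromℕ< (s≤s r≤q) , 1ℤ , inj₁ refl , ∣-respʳ
            (cong (λ t → x - t) (sym (trans (ℤ.*-identityˡ _) (cong +_ (toℕ-fromℕ< (s≤s r≤q)))))) p∣x-r
  ...   | no r≰q = fromℕ< s<1+q , -1ℤ , inj₂ refl , ∣-respʳ
            (trans (cong (λ t → x - + toℕ r + t) P≡s+r) (trans (shift x (+ toℕ r) (+ s))
              (cong (λ t → x - -1ℤ * + t) (sym (toℕ-fromℕ< s<1+q)))))
            (∣m∣n⇒∣m+n p∣x-r ∣-refl)
    where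
    s = p ∸ toℕ r
    P≡s+r : P ≡ + s + + toℕ r
    P≡s+r = cong +_ (sym (ℕ.m∸n+n≡m (ℕ.<⇒≤ (toℕ<n r))))
    s<1+q : s ℕ.< suc q
    s<1+q = s≤s (ℕ.≤-trans (ℕ.∸-monoʳ-≤ p (ℕ.≰⇒> r≰q))
      (ℕ.≤-reflexive (trans (cong (_∸ suc q) p≡q+1+q) (ℕ.m+n∸n≡m q (suc q)))))
    shift : ∀ x r s → x - r + (s + r) ≡ x - -1ℤ * s
    shift = solve-∀

  signedResidue-injective : ∀ {ε i j} → IsSign ε → i ℕ.≤ q → j ℕ.≤ q →
                            P ∣ + j - ε * + i → i ≡ j
  signedResidue-injective {i = i} {j} (inj₁ refl) i≤q j≤q d =
    sym (residue-injective (below j≤q) (below i≤q)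
      (∣-respʳ (cong (λ t → + j - t) (ℤ.*-identityˡ (+ i))) d))
    where
    below : ∀ {k} → k ℕ.≤ q → k ℕ.< p
    below k≤q = subst (_ ℕ.<_) (sym p≡q+1+q) (ℕ.≤-trans (s≤s k≤q) (ℕ.m≤n+m (suc q) q))
  -- With the sign -1, p divides i + j ≤ 2q < p, so both are 0.
  signedResidue-injective {i = i} {j} (inj₂ refl) i≤q j≤q d =
    trans (ℕ.m+n≡0⇒n≡0 j j+i≡0) (sym (ℕ.m+n≡0⇒m≡0 j j+i≡0))
    where
    minus-neg : ∀ x y → x - -1ℤ * y ≡ x + y
    minus-neg = solve-∀
    j+i≡0 : j ℕ.+ i ≡ 0
    j+i≡0 = ℤ.+-injective (multiple-below⇒0 (∣-respʳ (minus-neg (+ j) (+ i)) d)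
      (subst (_ ℕ.<_) (sym p≡q+1+q) (ℕ.+-mono-≤-< j≤q (s≤s i≤q))))

  -- The subgroup generated by p - 1.

  ⟨p-1⟩ : Pred (Group.Carrier (ℤ/-units (p ^ 2))) 0ℓ
  ⟨p-1⟩ = Generated (ℤ/-units (p ^ 2)) (predUnit p)

  -- Induction on the generation of g: the generator is -1 modulo p, and being a sign modulo p
  -- survives products and inverses.
  generated⇒±1 : ∀ {g} → g ∈ ⟨p-1⟩ → ∃[ ε ] IsSign ε × P ∣ proj₁ g - ε
  generated⇒±1 generator = -1ℤ , inj₂ refl , divides 1ℤ (expand P)
    where
    expand : ∀ x → x - 1ℤ - -1ℤ ≡ 1ℤ * x
    expand = solve-∀
  generated⇒±1 (respects {x , _} {y , _} x≈y gen) with ε , s , d ← generated⇒±1 gen =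
    ε , s , ∣-respʳ (expand x y ε) (∣m∣n⇒∣m-n d (P²∣⇒P∣ (≈⇒P²∣ x≈y)))
    where
    expand : ∀ x y ε → x - ε - (x - y) ≡ y - ε
    expand = solve-∀
  generated⇒±1 (product {x , _} {y , _} gen gen′)
    with ε , s , d ← generated⇒±1 gen | δ , t , e ← generated⇒±1 gen′ =
    ε * δ , sign-* s t , ∣-respʳ (expand x y ε δ) (∣m∣n⇒∣m+n (∣m⇒∣m*n y d) (∣n⇒∣m*n ε e))
    where
    expand : ∀ x y ε δ → (x - ε) * y + ε * (y - δ) ≡ x * y - ε * δ
    expand = solve-∀
  generated⇒±1 identity = 1ℤ , inj₁ refl , divides 0ℤ refl
  -- A sign is its own inverse: modulo p, y ≡ ε²y ≡ εxy ≡ ε.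
  generated⇒±1 (inverse {x , y , yx≈1 , _} gen) with ε , s , d ← generated⇒±1 gen =
    ε , s , ∣-respʳ (trans (expand x y ε) (cong (_- ε) (trans (cong (_* y) (sign²≡1 s)) (ℤ.*-identityˡ y))))
      (∣m∣n⇒∣m-n (∣n⇒∣m*n ε (P²∣⇒P∣ (≈⇒P²∣ yx≈1))) (∣n⇒∣m*n (ε * y) d))
    where
    expand : ∀ x y ε → ε * (y * x - 1ℤ) - ε * y * (x - ε) ≡ ε * ε * y - ε
    expand = solve-∀

  attained-resp-≈ : ∀ {x y} → x ≈ y → Attained ⟨p-1⟩ y → Attained ⟨p-1⟩ x
  attained-resp-≈ x≈y (attained g g∈G y≈g) = attained g g∈G (≈-trans x≈y y≈g)

  attained-* : ∀ {x y} → Attained ⟨p-1⟩ x → Attained ⟨p-1⟩ y → Attained ⟨p-1⟩ (x * y)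
  attained-* (attained g g∈G x≈g) (attained h h∈G y≈h) =
    attained _ (product g∈G h∈G) (≈-*-cong x≈g y≈h)

  attained-p-1 : Attained ⟨p-1⟩ (P - 1ℤ)
  attained-p-1 = attained (predUnit p) generator (P²∣⇒≈ (divides 0ℤ (ℤ.+-inverseʳ (P - 1ℤ))))

  -- The product (1 + ap)(1 + bp) differs from the target by abp², so multiplication adds the
  -- coefficients of p.
  attained-1+ap+bp : ∀ a b → Attained ⟨p-1⟩ (1ℤ + a * P) → Attained ⟨p-1⟩ (1ℤ + b * P) →
                     Attained ⟨p-1⟩ (1ℤ + (a + b) * P)
  attained-1+ap+bp a b A B =
    attained-resp-≈ (P²∣⇒≈ (divides (- (a * b)) (expand a b P))) (attained-* A B)
    where
    expand : ∀ a b p → 1ℤ + (a + b) * p - (1ℤ + a * p) * (1ℤ + b * p) ≡ - (a * b) * (p * p)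
    expand = solve-∀

  attained-1+kap : ∀ k a → Attained ⟨p-1⟩ (1ℤ + a * P) → Attained ⟨p-1⟩ (1ℤ + + k * a * P)
  attained-1+kap 0 a A = attained (Group.ε (ℤ/-units (p ^ 2))) identity
    (P²∣⇒≈ (divides 0ℤ (expand a P)))
    where
    expand : ∀ a p → 1ℤ + 0ℤ * a * p - 1ℤ ≡ 0ℤ
    expand = solve-∀
  attained-1+kap (suc k) a A =
    subst (Attained ⟨p-1⟩) (expand (+ k) a P) (attained-1+ap+bp a (+ k * a) A (attained-1+kap k a A))
    where
    expand : ∀ k a p → 1ℤ + (a + k * a) * p ≡ 1ℤ + (1ℤ + k) * a * p
    expand = solve-∀

  -- (p - 1)² ≡ 1 - 2p.
  attained-1-2p : Attained ⟨p-1⟩ (1ℤ + - (+ 2) * P)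
  attained-1-2p = attained-resp-≈ (P²∣⇒≈ (divides -1ℤ (expand P)))
    (attained-* attained-p-1 attained-p-1)
    where
    expand : ∀ p → 1ℤ + - (+ 2) * p - (p - 1ℤ) * (p - 1ℤ) ≡ -1ℤ * (p * p)
    expand = solve-∀

  -- As p = 2q + 1, the exponents q and q + 1 turn 1 - 2p into 1 + p and 1 - p.
  attained-1+p : Attained ⟨p-1⟩ (1ℤ + 1ℤ * P)
  attained-1+p = attained-resp-≈
    (P²∣⇒≈ (divides 1ℤ (subst (λ t → 1ℤ + 1ℤ * t - (1ℤ + Q * - (+ 2) * t) ≡ 1ℤ * (t * t))
      (sym P≡Q+1+Q) (expand Q))))
    (attained-1+kap q (- (+ 2)) attained-1-2p)
    where
    expand : ∀ q → let p = q + (1ℤ + q) in 1ℤ + 1ℤ * p - (1ℤ + q * - (+ 2) * p) ≡ 1ℤ * (p * p)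
    expand = solve-∀

  attained-1-p : Attained ⟨p-1⟩ (1ℤ + -1ℤ * P)
  attained-1-p = attained-resp-≈
    (P²∣⇒≈ (divides 1ℤ (subst (λ t → 1ℤ + -1ℤ * t - (1ℤ + (1ℤ + Q) * - (+ 2) * t) ≡ 1ℤ * (t * t))
      (sym P≡Q+1+Q) (expand Q))))
    (attained-1+kap (suc q) (- (+ 2)) attained-1-2p)
    where
    expand : ∀ q → let p = q + (1ℤ + q) in 1ℤ + -1ℤ * p - (1ℤ + (1ℤ + q) * - (+ 2) * p) ≡ 1ℤ * (p * p)
    expand = solve-∀

  -- Powers of 1 + p reach the nonnegative coefficients. As `attained-1+kap` takes natural
  -- exponents, the negative ones come from powers of 1 - p.
  attained-1+ap : ∀ a → Attained ⟨p-1⟩ (1ℤ + a * P)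
  attained-1+ap (+ k) =
    subst (λ t → Attained ⟨p-1⟩ (1ℤ + t * P)) (ℤ.*-identityʳ (+ k)) (attained-1+kap k 1ℤ attained-1+p)
  attained-1+ap -[1+ k ] =
    subst (λ t → Attained ⟨p-1⟩ (1ℤ + t * P)) (expand (+ suc k)) (attained-1+kap (suc k) -1ℤ attained-1-p)
    where
    expand : ∀ k → k * -1ℤ ≡ - k
    expand = solve-∀

  attained-sign : ∀ {ε} → IsSign ε → Attained ⟨p-1⟩ ε
  attained-sign (inj₁ refl) = attained-1+ap 0ℤ
  attained-sign (inj₂ refl) = attained-resp-≈ (P²∣⇒≈ (divides -1ℤ (expand P)))
    (attained-* attained-p-1 (attained-1+ap 1ℤ))
    where
    expand : ∀ p → -1ℤ - (p - 1ℤ) * (1ℤ + 1ℤ * p) ≡ -1ℤ * (p * p)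
    expand = solve-∀

  -- If z = ε + tp, then ε² = 1 gives z = ε(1 + εtp), a product of two attained values.
  ±1⇒attained : ∀ {ε z} → IsSign ε → P ∣ z - ε → Attained ⟨p-1⟩ z
  ±1⇒attained {ε} {z} sign (divides t z-ε≡tP) = subst (Attained ⟨p-1⟩) eq
    (attained-* (attained-sign sign) (attained-1+ap (ε * t)))
    where
    expand : ∀ ε t p → ε * (1ℤ + ε * t * p) ≡ ε + ε * ε * (t * p)
    expand = solve-∀
    cancel : ∀ ε z → ε + 1ℤ * (z - ε) ≡ z
    cancel = solve-∀
    eq : ε * (1ℤ + ε * t * P) ≡ z
    eq = trans (expand ε t P) (trans
      (cong₂ (λ x y → ε + x * y) (sign²≡1 sign) (sym z-ε≡tP)) (cancel ε z))

  -- Equality of cosets expressed by congruences.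

  -- Equality of the cosets of r and s under the group of units ≡ ±1 (mod p).
  record Associated (r s : ℤ) : Set where
    constructor associated
    field
      ε       : ℤ
      sign    : IsSign ε
      related : (P * P ∣ s - ε * r) ⊎ (¬ P ∣ r) × (P ∣ s - ε * r)

  associated-mod-p : ∀ {r s} → Associated r s → ∃[ ε ] IsSign ε × P ∣ s - ε * r
  associated-mod-p (associated ε sign (inj₁ d))       = ε , sign , P²∣⇒P∣ d
  associated-mod-p (associated ε sign (inj₂ (_ , d))) = ε , sign , d

  associated-mod-p² : ∀ {r s} → P ∣ r → Associated r s → ∃[ ε ] IsSign ε × P * P ∣ s - ε * r
  associated-mod-p² P∣r (associated ε sign (inj₁ d))         = ε , sign , d
  associated-mod-p² P∣r (associated ε sign (inj₂ (P∤r , _))) = contradiction P∣r P∤r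

  -- Modulo p², s - εr is r(g - ε). The second factor is divisible by p, and if p ∣ r the first
  -- factor supplies another p.
  ±1-multiple⇒associated : ∀ r s g {ε} → IsSign ε → P ∣ g - ε → P * P ∣ s - r * g → Associated r s
  ±1-multiple⇒associated r s g {ε} sign P∣g-ε d = associated ε sign (cases (P ∣? r))
    where
    expand : s - r * g + r * (g - ε) ≡ s - ε * r
    expand = regroup r s g ε
      where
      regroup : ∀ r s g ε → s - r * g + r * (g - ε) ≡ s - ε * r
      regroup = solve-∀
    P²∣* : P ∣ r → P * P ∣ r * (g - ε)
    P²∣* P∣r = ∣-trans (*-monoˡ-∣ P P∣r) (*-monoʳ-∣ r P∣g-ε)
    cases : Dec (P ∣ r) → P * P ∣ s - ε * r ⊎ (¬ P ∣ r) × (P ∣ s - ε * r)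
    cases (yes P∣r) = inj₁ (∣-respʳ expand (∣m∣n⇒∣m+n d (P²∣* P∣r)))
    cases (no P∤r)  = inj₂ (P∤r , ∣-respʳ expand (∣m∣n⇒∣m+n (P²∣⇒P∣ d) (∣n⇒∣m*n r P∣g-ε)))

  P∣⁻¹ : ∀ {ε} r s → IsSign ε → P ∣ s - ε * r → P ∣ s → P ∣ r
  P∣⁻¹ {ε} r s sign P∣s-εr P∣s =
    ∣-respʳ (trans (expand ε r s) (trans (cong (_* r) (sign²≡1 sign)) (ℤ.*-identityˡ r)))
      (∣n⇒∣m*n ε (∣m∣n⇒∣m-n P∣s P∣s-εr))
    where
    expand : ∀ ε r s → ε * (s - (s - ε * r)) ≡ ε * ε * r
    expand = solve-∀

  associated-P∣ : ∀ {r s} → Associated r s → P ∣ r → P ∣ s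
  associated-P∣ {r} {s} A P∣r with ε , _ , d ← associated-mod-p A =
    ∣-respʳ (expand ε r s) (∣m∣n⇒∣m+n d (∣n⇒∣m*n ε P∣r))
    where
    expand : ∀ ε r s → s - ε * r + ε * r ≡ s
    expand = solve-∀

  P∣P* : ∀ x → P ∣ P * x
  P∣P* x = ∣m⇒∣m*n x ∣-refl

  P∤suc : ∀ {k} → k ℕ.< q → ¬ P ∣ + suc k
  P∤suc k<q d with () ← multiple-below⇒0 d
    (subst (_ ℕ.<_) (sym p≡q+1+q) (ℕ.≤-trans (s≤s k<q) (ℕ.m≤n+m (suc q) q)))

  -- Representatives of the p cosets.

  cosetRep : Fin q ⊎ Fin (suc q) → ℤ
  cosetRep (inj₁ i) = + suc (toℕ i)
  cosetRep (inj₂ i) = P * + toℕ i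

  -- Association preserves divisibility by p in both directions, which separates the two kinds.
  -- Within a kind, after cancelling p from the multiples of p, signed residues modulo p are unique.
  cosetRep-injective : ∀ {i j} → Associated (cosetRep i) (cosetRep j) → i ≡ j
  cosetRep-injective {inj₁ i} {inj₁ j} A with ε , sign , d ← associated-mod-p A =
    cong inj₁ (toℕ-injective (ℕ.suc-injective
      (signedResidue-injective sign (toℕ<n i) (toℕ<n j) d)))
  cosetRep-injective {inj₁ i} {inj₂ j} A with ε , sign , d ← associated-mod-p A =
    contradiction (P∣⁻¹ (+ suc (toℕ i)) (P * + toℕ j) sign d (P∣P* (+ toℕ j))) (P∤suc (toℕ<n i))
  cosetRep-injective {inj₂ i} {inj₁ j} A =
    contradiction (associated-P∣ A (P∣P* (+ toℕ i))) (P∤suc (toℕ<n j))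
  cosetRep-injective {inj₂ i} {inj₂ j} A
    with ε , sign , d ← associated-mod-p² (P∣P* (+ toℕ i)) A =
    cong inj₂ (toℕ-injective (signedResidue-injective sign
      (ℕ.≤-pred (toℕ<n i)) (ℕ.≤-pred (toℕ<n j))
      (P²∣P*⇒P∣ (∣-respʳ (factor P ε (+ toℕ i) (+ toℕ j)) d))))
    where
    factor : ∀ p ε i j → p * j - ε * (p * i) ≡ p * (j - ε * i)
    factor = solve-∀

  cosetRep-covers : ∀ x → ∃[ i ] Associated (cosetRep i) x
  cosetRep-covers x with P ∣? x
  ... | yes (divides t x≡tP) with i , ε , sign , d ← signedResidue t =
    inj₂ i , (associated ε sign $ inj₁ $ ∣-respʳ
      (trans (expand P t ε (+ toℕ i)) (cong (_- ε * (P * + toℕ i)) (sym x≡tP)))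
      (P∣⇒P²∣P* d))
    where
    expand : ∀ p t ε i → p * (t - ε * i) ≡ t * p - ε * (p * i)
    expand = solve-∀
  ... | no P∤x with signedResidue x
  -- The signed residue 0 would make p divide x, so those of units are 1, ..., q.
  ...   | Fin.zero , ε , sign , d = contradiction (∣-respʳ (expand x ε) d) P∤x
    where
    expand : ∀ x ε → x - ε * 0ℤ ≡ x
    expand = solve-∀
  ...   | Fin.suc i , ε , sign , d = inj₁ i , associated ε sign (inj₂ (P∤suc (toℕ<n i) , d))

  p↔cosets : Fin p ↔ (Fin q ⊎ Fin (suc q))
  p↔cosets = subst (λ k → Fin k ↔ (Fin q ⊎ Fin (suc q))) (sym p≡q+1+q) +↔⊎

  -- Counting the x that are associated to x + a.

  P∤residue : ∀ {k} → suc k ℕ.< p → ∀ v → ¬ P ∣ + suc k + P * v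
  P∤residue {k} 1+k<p v d = contradiction (multiple-below⇒0
    (∣-respʳ (cancel (+ suc k) (P * v)) (∣m∣n⇒∣m-n d (P∣P* v))) 1+k<p) (λ ())
    where
    cancel : ∀ x y → x + y - y ≡ x
    cancel = solve-∀

  1+toℕ<p : (u : Fin (p ∸ 1)) → suc (toℕ u) ℕ.< p
  1+toℕ<p u = subst (suc (toℕ u) ℕ.<_) (ℕ.suc-pred p) (s≤s (toℕ<n u))

  nonzeroResidue : ∀ x → ¬ P ∣ x → ∃[ u ] P ∣ x - + suc (toℕ {p ∸ 1} u)
  nonzeroResidue x P∤x with r , d ← residue p x = cases (toℕ r) refl
    where
    cases : ∀ k → toℕ r ≡ k → ∃[ u ] P ∣ x - + suc (toℕ {p ∸ 1} u)
    cases 0       r≡0   = contradiction (∣-respʳ (trans (cong (λ k → x - + k) r≡0) (ℤ.+-identityʳ x)) d) P∤x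
    cases (suc k) r≡1+k = fromℕ< k<p-1 ,
      ∣-respʳ (cong (λ k → x - + k) (trans r≡1+k (cong suc (sym (toℕ-fromℕ< k<p-1))))) d
      where
      k<p-1 : k ℕ.< p ∸ 1
      k<p-1 = ℕ.≤-pred (subst (suc k ℕ.<_) (sym (ℕ.suc-pred p)) (subst (ℕ._< p) r≡1+k (toℕ<n r)))

  -- A class modulo p splits into p classes modulo p²; `v` is the residue of (x - c)/p.
  ≈-lift-residue : ∀ x c → P ∣ x - c → ∃[ v ] x ≈ c + P * + toℕ {p} v
  ≈-lift-residue x c (divides t x-c≡tP) with v , d ← residue p t =
    v , P²∣⇒≈ (∣-respʳ (trans (expand P t (+ toℕ v))
      (trans (cong (_- P * + toℕ v) (sym x-c≡tP)) (regroup x c (P * + toℕ v)))) (P∣⇒P²∣P* d))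
    where
    expand : ∀ p t v → p * (t - v) ≡ t * p - p * v
    expand = solve-∀
    regroup : ∀ x c y → x - c - y ≡ x - (c + y)
    regroup = solve-∀

  -- `R` stands for f(x + a) = f(x). Only its equivalence with association enters the counts, which
  -- thus do not refer to the bijection behind f.
  module _ (a : ℤ) {R : Pred ℤ 0ℓ} (R⇒associated : ∀ {x} → R x → Associated x (x + a))
           (associated⇒R : ∀ {x} → Associated x (x + a) → R x) where

    -- As 2q = p - 1, c solves 2x + a ≡ 0 modulo p, and modulo p² when p ∣ a.
    private
      c : ℤ
      c = Q * a

    2c+a≡Pa : c + a - -1ℤ * c ≡ P * a
    2c+a≡Pa = trans (expand Q a) (cong (_* a) (sym P≡Q+1+Q))
      where
      expand : ∀ q a → q * a + a - -1ℤ * (q * a) ≡ (q + (1ℤ + q)) * a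
      expand = solve-∀

    -- Uniqueness of the solution c: since p - 2q = 1, p ∣ 2x + a forces x ≡ c modulo p, and p² ∣ 2x
    -- + a forces x ≡ c modulo p² when p ∣ x.
    Px-Q[2x+a]≡x-c : ∀ x → P * x - Q * (x + a - -1ℤ * x) ≡ x - c
    Px-Q[2x+a]≡x-c x = trans (cong (λ t → t * x - Q * (x + a - -1ℤ * x)) P≡Q+1+Q) (expand Q x a)
      where
      expand : ∀ q x a → (q + (1ℤ + q)) * x - q * (x + a - -1ℤ * x) ≡ x - q * a
      expand = solve-∀

    x+a-1x≡a : ∀ x → x + a - 1ℤ * x ≡ a
    x+a-1x≡a x = expand x a
      where
      expand : ∀ x a → x + a - 1ℤ * x ≡ a
      expand = solve-∀

    -- The sign 1 would give p ∣ a, so the sign is -1 and x lies in the class of c modulo p, which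
    -- has p lifts modulo p².
    solutions-nonmultiple : ¬ P ∣ a → HasCardinality (Subset (ℤ/-setoid (p ^ 2)) R) p
    solutions-nonmultiple P∤a = enumeration (Subset (ℤ/-setoid (p ^ 2)) R) (↔-id (Fin p))
      (λ v → rep v , associated⇒R (rep-associated v)) (λ {v} {w} → rep-injective v w)
      (λ (x , Rx) → covers x (associated-mod-p (R⇒associated Rx)))
      where
      rep : Fin p → ℤ
      rep v = c + P * + toℕ v

      P∣double : ∀ v → P ∣ rep v + a - -1ℤ * rep v
      P∣double v = ∣-respʳ
        (trans (cong (_+ P * (+ toℕ v + + toℕ v)) (sym 2c+a≡Pa)) (expand c a P (+ toℕ v)))
        (∣m∣n⇒∣m+n (P∣P* a) (P∣P* (+ toℕ v + + toℕ v)))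
        where
        expand : ∀ c a p v → c + a - -1ℤ * c + p * (v + v) ≡ c + p * v + a - -1ℤ * (c + p * v)
        expand = solve-∀

      rep-associated : ∀ v → Associated (rep v) (rep v + a)
      rep-associated v = associated -1ℤ (inj₂ refl) (inj₂
        -- The representatives are units: p ∣ x and p ∣ 2x + a would give p ∣ a.
        ((λ P∣x → P∤a (∣-respʳ (expand (rep v) a)
           (∣m∣n⇒∣m-n (P∣double v) (∣m∣n⇒∣m+n P∣x P∣x)))) , P∣double v))
        where
        expand : ∀ x a → x + a - -1ℤ * x - (x + x) ≡ a
        expand = solve-∀

      rep-injective : ∀ v w → rep v ≈ rep w → v ≡ w
      rep-injective v w v≈w = toℕ-injective (residue-injective (toℕ<n v) (toℕ<n w)
        (P²∣P*⇒P∣ (∣-respʳ (factor c P (+ toℕ v) (+ toℕ w)) (≈⇒P²∣ v≈w))))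
        where
        factor : ∀ c p v w → c + p * v - (c + p * w) ≡ p * (v - w)
        factor = solve-∀

      covers : ∀ x → ∃[ ε ] IsSign ε × P ∣ x + a - ε * x → ∃[ v ] x ≈ rep v
      covers x (_ , inj₁ refl , d) = contradiction (∣-respʳ (x+a-1x≡a x) d) P∤a
      covers x (_ , inj₂ refl , d) = ≈-lift-residue x c
        (∣-respʳ (Px-Q[2x+a]≡x-c x) (∣m∣n⇒∣m-n (P∣P* x) (∣n⇒∣m*n Q d)))

    -- A unit is indexed by its nonzero residue modulo p, shifted down by one, and by its lift. The
    -- summand `⊤` indexes c, the only solution divisible by p.
    solutions-multiple : P ∣ a → ¬ P * P ∣ a →
      HasCardinality (Subset (ℤ/-setoid (p ^ 2)) R) ((p ∸ 1) ℕ.* p ℕ.+ 1)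
    solutions-multiple P∣a P²∤a = enumeration (Subset (ℤ/-setoid (p ^ 2)) R)
      ((*↔× ⊎-↔ 1↔⊤) ↔-∘ +↔⊎)
      (λ i → rep i , associated⇒R (rep-associated i)) (λ {i} {j} → rep-injective i j)
      (λ (x , Rx) → covers x (R⇒associated Rx) (P ∣? x))
      where
      Index : Set
      Index = (Fin (p ∸ 1) × Fin p) ⊎ ⊤

      rep : Index → ℤ
      rep (inj₁ (u , v)) = + suc (toℕ u) + P * + toℕ v
      rep (inj₂ _)       = c

      P∣c : P ∣ c
      P∣c = ∣n⇒∣m*n Q P∣a

      P∤rep : ∀ u v → ¬ P ∣ rep (inj₁ (u , v))
      P∤rep u v = P∤residue (1+toℕ<p u) (+ toℕ v)

      rep-associated : ∀ i → Associated (rep i) (rep i + a)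
      rep-associated i@(inj₁ (u , v)) = associated 1ℤ (inj₁ refl)
        (inj₂ (P∤rep u v , ∣-respʳ (sym (x+a-1x≡a (rep i))) P∣a))
      rep-associated (inj₂ _) = associated -1ℤ (inj₂ refl)
        (inj₁ (∣-respʳ (sym 2c+a≡Pa) (P∣⇒P²∣P* P∣a)))

      P∣-resp-≈ : ∀ x y → x ≈ y → P ∣ y → P ∣ x
      P∣-resp-≈ x y x≈y P∣y = ∣-respʳ (cancel x y) (∣m∣n⇒∣m+n (P²∣⇒P∣ (≈⇒P²∣ x≈y)) P∣y)
        where
        cancel : ∀ x y → x - y + y ≡ x
        cancel = solve-∀

      rep-injective : ∀ i j → rep i ≈ rep j → i ≡ j
      rep-injective (inj₁ (u , v)) (inj₁ (w , z)) e = equal u≡w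
        where
        split : ∀ u w p v z → u + p * v - (w + p * z) - p * (v - z) ≡ u - w
        split = solve-∀
        u≡w : u ≡ w
        u≡w = toℕ-injective (ℕ.suc-injective (residue-injective (1+toℕ<p u) (1+toℕ<p w)
          (∣-respʳ (split (+ suc (toℕ u)) (+ suc (toℕ w)) P (+ toℕ v) (+ toℕ z))
            (∣m∣n⇒∣m-n (P²∣⇒P∣ (≈⇒P²∣ e)) (P∣P* (+ toℕ v - + toℕ z))))))
        factor : ∀ u p v z → u + p * v - (u + p * z) ≡ p * (v - z)
        factor = solve-∀
        equal : u ≡ w → _≡_ {A = Index} (inj₁ (u , v)) (inj₁ (w , z))
        equal refl = cong (λ t → inj₁ (u , t)) (toℕ-injective
          (residue-injective (toℕ<n v) (toℕ<n z)
            (P²∣P*⇒P∣ (∣-respʳ (factor (+ suc (toℕ u)) P (+ toℕ v) (+ toℕ z)) (≈⇒P²∣ e)))))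
      rep-injective (inj₁ (u , v)) (inj₂ _) e =
        contradiction (P∣-resp-≈ (rep (inj₁ (u , v))) c e P∣c) (P∤rep u v)
      rep-injective (inj₂ _) (inj₁ (u , v)) e =
        contradiction (P∣-resp-≈ (rep (inj₁ (u , v))) c (≈-sym e) P∣c) (P∤rep u v)
      rep-injective (inj₂ _) (inj₂ _) _ = refl

      covers : ∀ x → Associated x (x + a) → Dec (P ∣ x) → ∃[ i ] x ≈ rep i
      covers x A (yes P∣x) with associated-mod-p² P∣x A
      -- For p ∣ x the congruence holds modulo p², so the sign 1 would give p² ∣ a.
      ... | _ , inj₁ refl , d = contradiction (∣-respʳ (x+a-1x≡a x) d) P²∤a
      ... | _ , inj₂ refl , d = inj₂ tt , P²∣⇒≈ (∣-respʳ (Px-Q[2x+a]≡x-c x)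
              (∣m∣n⇒∣m-n (P∣⇒P²∣P* P∣x) (∣n⇒∣m*n Q d)))
      covers x A (no P∤x) with u , d ← nonzeroResidue x P∤x
                          with v , e ← ≈-lift-residue x (+ suc (toℕ u)) d = inj₁ (u , v) , e

  -- Cosets of a subgroup consisting of the units that are ±1 modulo p.

  module _ (G : Subgroup (ℤ/-units (p ^ 2)) 0ℓ)
    (member⇒±1 : ∀ {g} → g ∈ Subgroup.Member G → ∃[ ε ] IsSign ε × P ∣ proj₁ g - ε)
    (±1⇒member : ∀ {ε z} → IsSign ε → P ∣ z - ε → Attained (Subgroup.Member G) z) where

    ∈-Coset⇒associated : ∀ {r s} → s ∈ Coset G r → Associated r s
    ∈-Coset⇒associated {r} {s} (g , g∈G , s≈rg) =
      let ε , sign , P∣g-ε = member⇒±1 g∈G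
      in ±1-multiple⇒associated r s (proj₁ g) sign P∣g-ε (≈⇒P²∣ s≈rg)

    cosets-equal⇒associated : ∀ {r s} → Coset G r ≐ Coset G s → Associated r s
    cosets-equal⇒associated {s = s} (_ , s⊆r) = ∈-Coset⇒associated {s = s} (s⊆r (∈-Coset G s))

    ∈-Coset-attained : ∀ r s {z} → Attained (Subgroup.Member G) z → P * P ∣ s - r * z → s ∈ Coset G r
    ∈-Coset-attained r s (attained g g∈G z≈g) d = g , g∈G ,
      ≈-trans (P²∣⇒≈ d) (≈-*-cong (P²∣⇒≈ {r} {r} (divides 0ℤ (ℤ.+-inverseʳ r))) z≈g)

    -- If s = εr + tp and r r′ ≡ 1 (mod p), then s ≡ r (ε + t r′ p) (mod p²).
    P∤r⇒∈-Coset : ∀ {ε} r s → IsSign ε → ¬ P ∣ r → P ∣ s - ε * r → s ∈ Coset G r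
    P∤r⇒∈-Coset {ε} r s sign P∤r (divides t s-εr≡tP) =
      ∈-Coset-attained r s (±1⇒member sign (divides (t * r′) (cancel ε (t * r′ * P))))
        (∣-respʳ eq (P∣⇒P²∣P* (∣n⇒∣m*n (- t) (proj₂ inverse-r))))
      where
      inverse-r : ∃[ r′ ] P ∣ r * r′ - 1ℤ
      inverse-r = prime∤⇒invertible p-prime r P∤r
      r′ = proj₁ inverse-r
      cancel : ∀ x y → x + y - x ≡ y
      cancel = solve-∀
      expand : ∀ r r′ t p → p * (- t * (r * r′ - 1ℤ)) ≡ t * p - r * (t * r′ * p)
      expand = solve-∀
      regroup : ∀ r s ε y → s - ε * r - r * y ≡ s - r * (ε + y)
      regroup = solve-∀
      eq : P * (- t * (r * r′ - 1ℤ)) ≡ s - r * (ε + t * r′ * P)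
      eq = trans (expand r r′ t P)
        (trans (cong (_- r * (t * r′ * P)) (sym s-εr≡tP)) (regroup r s ε (t * r′ * P)))

    -- A congruence modulo p² takes the multiplier ε itself; one modulo p only comes with p ∤ r, and
    -- ε is then corrected by a multiple of p.
    associated⇒∈-Coset : ∀ {r s} → Associated r s → s ∈ Coset G r
    associated⇒∈-Coset {r} {s} (associated ε sign (inj₁ d)) = ∈-Coset-attained r s
      (±1⇒member sign (divides 0ℤ (ℤ.+-inverseʳ ε)))
      (∣-respʳ (cong (λ t → s - t) (ℤ.*-comm ε r)) d)
    associated⇒∈-Coset {r} {s} (associated ε sign (inj₂ (P∤r , d))) = P∤r⇒∈-Coset r s sign P∤r d

    associated⇒cosets-equal : ∀ {r s} → Associated r s → Coset G r ≐ Coset G s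
    associated⇒cosets-equal {r} {s} A = Coset-unique G {r} {s} (associated⇒∈-Coset A)

    -- The zero-difference property of the coset index function.

    module _ {d : ℕ} (h : Bijection (Cosets G) (ℤ/-setoid d)) where
      private
        module h = Bijection h
        module ℤ/d = CommutativeRing (ℤ/ d)

      image-cardinality : HasCardinality (Image (cosetIndex G h)) p
      image-cardinality = enumeration (Image (cosetIndex G h)) p↔cosets
        (λ i → h.to (cosetRep i) , cosetRep i , ℤ/d.refl)
        (λ e → cosetRep-injective (cosets-equal⇒associated (h.injective e)))
        (λ (y , x , hx≈y) → let i , A = cosetRep-covers x in
          i , ℤ/d.trans (ℤ/d.sym hx≈y) (ℤ/d.sym (h.cong (associated⇒cosets-equal A))))

      Stable : ℤ → Pred ℤ 0ℓ
      Stable a x = h.to (x + a) ℤ/d.≈ h.to x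

      -- As `h` is injective on cosets, f(x + a) = f(x) amounts to association of x and x + a; the
      -- two counts then apply according to whether p ∣ a.
      difference-cardinality : ∀ a → ¬ a ≈ 0ℤ →
        ∃[ k ] (k ∈ ｛ p ｝ ∪ ｛ p ^ 2 ∸ p ℕ.+ 1 ｝) × HasCardinality (Subset (ℤ/-setoid (p ^ 2)) (Stable a)) k
      difference-cardinality a a≉0 = cases (P ∣? a)
        where
        stable⇒associated : ∀ {x} → Stable a x → Associated x (x + a)
        stable⇒associated e = cosets-equal⇒associated (h.injective (ℤ/d.sym e))
        associated⇒stable : ∀ {x} → Associated x (x + a) → Stable a x
        associated⇒stable A = ℤ/d.sym (h.cong (associated⇒cosets-equal A))
        size : p ^ 2 ∸ p ℕ.+ 1 ≡ (p ∸ 1) ℕ.* p ℕ.+ 1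
        size = cong (ℕ._+ 1) (trans
          (cong₂ _∸_ (cong (p ℕ.*_) (ℕ.*-identityʳ p)) (sym (ℕ.*-identityˡ p)))
          (sym (ℕ.*-distribʳ-∸ p p 1)))
        P²∤a : ¬ P * P ∣ a
        P²∤a = a≉0 ∘ P²∣⇒≈ ∘ ∣-respʳ (sym (ℤ.+-identityʳ a))
        cases : Dec (P ∣ a) → ∃[ k ] (k ∈ ｛ p ｝ ∪ ｛ p ^ 2 ∸ p ℕ.+ 1 ｝) ×
                                     HasCardinality (Subset (ℤ/-setoid (p ^ 2)) (Stable a)) k
        cases (yes P∣a) = _ , inj₂ size ,
          solutions-multiple a stable⇒associated associated⇒stable P∣a P²∤a
        cases (no P∤a) = p , inj₁ refl ,
          solutions-nonmultiple a stable⇒associated associated⇒stable P∤a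

      cosetIndex-isZeroDifference : HasCardinality (Cosets G) d →
        IsZeroDifference (ℤ/-additive (p ^ 2)) (ℤ/-additive d) (p ^ 2) p
          (｛ p ｝ ∪ ｛ p ^ 2 ∸ p ℕ.+ 1 ｝) (cosetIndex G h)
      cosetIndex-isZeroDifference cosets-finite = record
        { domain-size     = ℤ/-cardinality (p ^ 2) {{ℕ.m^n≢0 p 2}}
        -- The index of the coset of 0 is an element of `Fin d`, hence d > 0.
        ; codomain-finite = d , ℤ/-cardinality d
            {{ℕ.>-nonZero (ℕ.≤-<-trans z≤n (toℕ<n (Bijection.to cosets-finite 0ℤ)))}}
        ; image-size      = image-cardinality
        ; differences     = difference-cardinality
        }

-- Odd p as 2q + 1, and the theorem.

odd⇒≡half+1+half : ∀ {p} → 2 ∤ p → p ≡ p / 2 ℕ.+ suc (p / 2)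
odd⇒≡half+1+half {p} 2∤p with p % 2 in p%2≡r | m%n<n p 2 | m≡m%n+[m/n]*n p 2
... | 0 | _ | _ = contradiction (ℕ.m%n≡0⇒n∣m p 2 p%2≡r) 2∤p
... | 1 | _ | p≡1+[p/2]*2 = trans p≡1+[p/2]*2 (regroup (p / 2))
  where
  regroup : ∀ q → 1 ℕ.+ q ℕ.* 2 ≡ q ℕ.+ suc q
  regroup = ℕSolver.solve-∀
... | suc (suc _) | s≤s (s≤s ()) | _

open import Data.Nat.Base using (_+_)

theorem3p5 : (p : ℕ) → Prime p → 2 ∤ p →
    let n = p ^ 2
        G = generatedBy (ℤ/-units n) (predUnit p)
    in (d : ℕ) → HasCardinality (Cosets G) d →
       (h : Bijection (Cosets G) (ℤ/-setoid d)) →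
       IsZeroDifference (ℤ/-additive n) (ℤ/-additive d)
         n p (｛ p ｝ ∪ ｛ p ^ 2 ∸ p + 1 ｝) (cosetIndex G h)
theorem3p5 p p-prime 2∤p d cosets-finite h =
  cosetIndex-isZeroDifference {q = p / 2} p-prime p≡q+1+q
    (generatedBy (ℤ/-units (p ^ 2)) (predUnit p))
    (generated⇒±1 {q = p / 2} p-prime p≡q+1+q) (±1⇒attained {q = p / 2} p-prime p≡q+1+q)
    h cosets-finite
  where
  p≡q+1+q : p ≡ p / 2 ℕ.+ suc (p / 2)
  p≡q+1+q = odd⇒≡half+1+half 2∤p
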